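{- For arbitrarily large $q$ (i.e. for every integer $N$ there is some $q\ge N$) there exist a planar graph $G$, a dominating set $D$ of $G$ with $|D|=q$, and an owner assignment $m:V(G)\to D$ such that $$W=4|D|-12,\qquad |A|=|D|-6,$$ and moreover $D$ is a minimum dominating set of $G$. Consequently, the coefficient one of $|D|$ in the bound $|A|\le(|D|-3)^+$ cannot be replaced by a smaller constant, even when $D$ is minimum: for no constant $c<1$ does $|A|\le(c|D|-3)^+$ hold for all planar graphs $G$, all minimum dominating sets $D$ of $G$ and all owner assignments $m$.
   Context: All graphs are finite, simple and undirected. For $z\in\mathbb R$, $z^+=\max\{z,0\}$. $N(v)$ is the open neighborhood of $v$. Let $D$ be a dominating set of $G$ (every vertex is in $D$ or has a neighbor in $D$). An owner assignment is a map $m:V(G)\to D$ such that $m(d)=d$ for every $d\in D$, and $xm(x)\in E(G)$ for every $x\notin D$. For $d\in D$ the owner block of $d$ is $B_d=m^{ -1}(d)$. For $x\in V(G)\setminus D$ set $$k_x=\bigl|\{c\in D\setminus\{m(x)\}:N(x)\cap B_c\neq\varnothing\}\bigr|.$$ Further set $W=\sum_{x\in V(G)\setminus D}(k_x-2)^+$ and $A=\{x\in V(G)\setminus D:k_x\ge 6\}$. -}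

module Defs where

open import Data.Fin using (Fin) renaming (_<_ to _<ᶠ_)
open import Data.Fin.Properties using (_≟_)
open import Data.Fin.Subset using (Subset; _∈_; _∩_; _-_; ∣_∣)
open import Data.Fin.Subset.Properties using (_∈?_; nonempty?)
open import Data.Integer using (+_)
open import Data.List using (List; []; _∷_; map; filter; allFin)
open import Data.Nat as ℕ using (ℕ; _∸_)
open import Data.Nat.ListAction using (sum)
open import Data.Product using (_×_; _,_; ∃-syntax)
open import Data.Rational as ℚ using (ℚ; 0ℚ; 1ℚ; _/_)
open import Data.Sum using (_⊎_)
open import Data.Vec using (tabulate)
open import Function using (_∘_)
open import Level using (Level)
open import Relation.Binary using (Decidable; Symmetric; Irreflexive)
open import Relation.Binary.PropositionalEquality using (_≡_; _≢_)
open import Relation.Nullary using (¬_; does; ¬?; _×-dec_)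
import Relation.Unary as U

record Graph (n : ℕ) : Set₁ where
  field
    Adj    : Fin n → Fin n → Set
    adj?   : Decidable Adj
    sym    : Symmetric Adj
    irrefl : Irreflexive _≡_ Adj

subset : ∀ {n} {ℓ : Level} {P : Fin n → Set ℓ} → U.Decidable P → Subset n
subset P? = tabulate (does ∘ P?)

module _ {n : ℕ} (G : Graph n) where
  open Graph G

  N : Fin n → Subset n
  N v = subset (adj? v)

  IsDominating : Subset n → Set
  IsDominating D = ∀ v → v ∈ D ⊎ ∃[ d ] (d ∈ D × Adj v d)

  IsMinimumDominating : Subset n → Set
  IsMinimumDominating D =
    IsDominating D × (∀ D′ → IsDominating D′ → ∣ D ∣ ℕ.≤ ∣ D′ ∣)

  record OwnerAssignment (D : Subset n) : Set where
    field
      m       : Fin n → Fin n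
      m∈D     : ∀ x → m x ∈ D
      m-fixes : ∀ d → d ∈ D → m d ≡ d
      m-adj   : ∀ x → ¬ x ∈ D → Adj x (m x)

  module _ {D : Subset n} (o : OwnerAssignment D) where
    open OwnerAssignment o

    block : Fin n → Subset n
    block d = subset (λ v → m v ≟ d)

    k : Fin n → ℕ
    k x = ∣ subset (λ c → (c ∈? (D - m x)) ×-dec nonempty? (N x ∩ block c)) ∣

    -- On ℕ, truncated subtraction k x ∸ 2 is the positive part (k x - 2)⁺.
    W : ℕ
    W = sum (map (λ x → k x ∸ 2) (filter (λ x → ¬? (x ∈? D)) (allFin n)))

    A : Subset n
    A = subset (λ x → ¬? (x ∈? D) ×-dec (6 ℕ.≤? k x))

-- Plane drawings have simple polygonal arcs as edges, with rational
-- coordinates.  Segments with rational endpoints that meet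
-- do so in a rational point, and overlap in a segment with rational
-- endpoints, so disjointness over ℚ and over the reals agree; every
-- planar graph has a drawing of this kind.

Point : Set
Point = ℚ × ℚ

OnSegment : Point → Point → Point → Set
OnSegment (a₁ , a₂) (b₁ , b₂) p = ∃[ t ] (0ℚ ℚ.≤ t × t ℚ.≤ 1ℚ ×
  p ≡ ( (1ℚ ℚ.- t) ℚ.* a₁ ℚ.+ t ℚ.* b₁
      , (1ℚ ℚ.- t) ℚ.* a₂ ℚ.+ t ℚ.* b₂ ))

-- The polygonal path from a to b whose successive bends are listed.
OnPath : Point → List Point → Point → Point → Set
OnPath a []       b p = OnSegment a b p
OnPath a (c ∷ cs) b p = OnSegment a c p ⊎ OnPath c cs b p

-- Each segment meets the rest of the path only at their common endpoint,
-- so the path is homeomorphic to a closed interval.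
IsArc : Point → List Point → Point → Set
IsArc a []       b = a ≢ b
IsArc a (c ∷ cs) b =
  a ≢ c × IsArc c cs b × (∀ p → OnSegment a c p → OnPath c cs b p → p ≡ c)

-- Each edge {u , v} is represented once, by the pair with u < v; the
-- value of bends at any other pair is irrelevant.
record PlaneDrawing {n : ℕ} (G : Graph n) : Set where
  open Graph G

  Edge : Fin n → Fin n → Set
  Edge u v = u <ᶠ v × Adj u v

  field
    pos   : Fin n → Point
    bends : Fin n → Fin n → List Point

  OnEdge : Fin n → Fin n → Point → Set
  OnEdge u v = OnPath (pos u) (bends u v) (pos v)

  Interior : Fin n → Fin n → Point → Set
  Interior u v p = OnEdge u v p × p ≢ pos u × p ≢ pos v

  field
    pos-injective   : ∀ u v → pos u ≡ pos v → u ≡ v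
    edges-arcs      : ∀ u v → Edge u v → IsArc (pos u) (bends u v) (pos v)
    avoids-vertices : ∀ u v → Edge u v → ∀ p → Interior u v p →
                      ∀ w → p ≢ pos w
    avoids-edges    : ∀ u v u′ v′ → Edge u v → Edge u′ v′ →
                      (u , v) ≢ (u′ , v′) →
                      ∀ p → Interior u v p → ¬ OnEdge u′ v′ p

Planar : ∀ {n} → Graph n → Set
Planar = PlaneDrawing

-- Real numbers as Cauchy sequences of rationals, with arithmetic
-- performed termwise; rationals are the constant sequences.

Eventually : (ℕ → Set) → Set
Eventually P = ∃[ n₀ ] (∀ n → n₀ ℕ.≤ n → P n)

IsCauchy : (ℕ → ℚ) → Set
IsCauchy x = ∀ ε → 0ℚ ℚ.< ε →
  ∃[ n₀ ] (∀ i j → n₀ ℕ.≤ i → n₀ ℕ.≤ j → ℚ.∣ x i ℚ.- x j ∣ ℚ.≤ ε)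

record ℝ : Set where
  field
    seq    : ℕ → ℚ
    cauchy : IsCauchy seq

open ℝ public

infix 4 _≤ˢ_ _<ˢ_

_≤ˢ_ _<ˢ_ : (ℕ → ℚ) → (ℕ → ℚ) → Set
x ≤ˢ y = ∀ ε → 0ℚ ℚ.< ε → Eventually (λ n → x n ℚ.≤ y n ℚ.+ ε)
x <ˢ y = ∃[ ε ] (0ℚ ℚ.< ε × Eventually (λ n → x n ℚ.+ ε ℚ.≤ y n))

fromℕ : ℕ → ℚ
fromℕ a = + a / 1

infix 8 _⁺

_⁺ : ℚ → ℚ
z ⁺ = z ℚ.⊔ 0ℚ

{-# OPTIONS --safe #-}
module Submission where

-- Take the cube of a path, x_i ~ x_j iff 0 < |i - j| ≤ 3, a triangulation on q vertices, and hang a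
-- pendant d_i on every x_i; D consists of the pendants.  Then k at x_i is the degree of x_i in the
-- triangulation: 3, 4, 5 at either end and 6 elsewhere.  The closed neighbourhoods of the pendants
-- are disjoint, so D is minimum.
--
-- The x_i are drawn on three rays in turn, at distances growing by a factor 4, each d_i close to x_i,
-- and all edges are straight.  Adding the vertices in the order x_0, d_0, x_1, d_1, …, each new edge
-- uv has a line through u that separates v from all the other earlier vertices.

open import Defs
open import Data.Nat using (ℕ; _≤_)
open import Data.Integer as ℤ using (+_)
open import Data.Rational as ℚ using (1ℚ)
open import Data.Fin.Subset using (Subset; ∣_∣)
open import Data.Product using (Σ-syntax; ∃-syntax; _×_)
open import Function using (const)
open import Relation.Binary.PropositionalEquality using (_≡_)
open import Relation.Nullary using (¬_)

import Algebra.Properties.CommutativeMonoid.Sum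
open import Data.Bool using (Bool; true; false; T; if_then_else_; _∧_)
open import Data.Fin using (Fin; zero; suc; toℕ)
open import Data.Fin.Properties using (toℕ-injective; suc-injective; _≟_)
open import Data.Fin.Subset using (inside; outside; _∈_; _∉_; _∩_; Nonempty)
open import Data.Fin.Subset.Properties using (_∈?_; nonempty?; x∈p∩q⁺; x∈p∩q⁻; x∈p∧x≢y⇒x∈p-y; p─q⊆p)
import Data.Integer.Properties as ℤₚ
open import Data.List as List using ([]; filter)
open import Data.Nat as ℕ using (zero; suc; s≤s; z≤n)
open import Data.Nat.Coprimality as Coprimality using (Coprime; 1-coprimeTo)
open import Data.Nat.ListAction using () renaming (sum to sumᴸ)
import Data.Nat.Properties as ℕₚ
open import Data.Nat.Solver using () renaming (module +-*-Solver to ℕ-Solver)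
open import Data.Product using (_,_; proj₁; proj₂)
open import Data.Rational using (ℚ; mkℚ; 0ℚ)
import Data.Rational.Properties as ℚₚ
open import Data.Rational.Solver using () renaming (module +-*-Solver to ℚ-Solver)
open import Data.Sum using (_⊎_; inj₁; inj₂; [_,_]′)
open import Data.Unit using (tt)
open import Data.Vec using ([]; _∷_; lookup; here; there)
open import Data.Vec.Properties using (lookup∘tabulate; lookup⇒[]=; []=⇒lookup)
open import Function using (_∘_; mk⇔)
open import Relation.Binary using (tri<; tri≈; tri>)
open import Relation.Binary.PropositionalEquality using (_≢_; refl; sym; trans; cong; cong₂; subst; subst₂)
open import Relation.Nullary using (contradiction; _×-dec_; ¬?; yes; no; Dec; does)
open import Relation.Nullary.Decidable using (True; toWitness; T?; does-⇔; dec-true; dec-false)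
import Relation.Unary as U

-- The cube of a path with a pendant at each vertex

-- Vertices are numbered x_0, d_0, x_1, d_1, …, so that x_i is 2i and d_i is 2i + 1.
near₀ : ℕ → Bool
near₀ 1 = true
near₀ 2 = true
near₀ 4 = true
near₀ 6 = true
near₀ _ = false

-- Recursion removes one pair from both arguments, so invariance under translation along the path
-- holds by computation. The drawing and the degree counts both rely on this.
near : ℕ → ℕ → Bool
near 0             v             = near₀ v
near 1             0             = true
near 1             (suc v)       = false
near (suc (suc u)) 0             = near₀ (suc (suc u))
near (suc (suc u)) 1             = false
near (suc (suc u)) (suc (suc v)) = near u v

near-sym : ∀ u v → near u v ≡ near v u
near-sym 0 0 = refl
near-sym 0 1 = refl
near-sym 0 (suc (suc v)) = refl
near-sym 1 0 = refl
near-sym 1 1 = refl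
near-sym 1 (suc (suc v)) = refl
near-sym (suc (suc u)) 0 = refl
near-sym (suc (suc u)) 1 = refl
near-sym (suc (suc u)) (suc (suc v)) = near-sym u v

near-irrefl : ∀ u → ¬ T (near u u)
near-irrefl (suc (suc u)) = near-irrefl u

graph : ∀ n → Graph n
graph n = record
  { Adj    = λ u v → T (near (toℕ u) (toℕ v))
  ; adj?   = λ u v → T? (near (toℕ u) (toℕ v))
  ; sym    = λ {u} {v} → subst T (near-sym (toℕ u) (toℕ v))
  ; irrefl = λ { {u} refl → near-irrefl (toℕ u) }
  }

module Drawing where

  open Data.Rational using (_+_; _*_; _-_; -_)
  open ℚₚ using (≤-trans; ≤-refl; ≤-reflexive; ≤-antisym; ≤-total; <⇒≤; <⇒≢; <-irrefl; ≤-<-trans; <-≤-trans; ≮⇒≥; ≰⇒>; +-inverseʳ; +-mono-≤; +-monoˡ-≤; +-monoʳ-≤; +-monoˡ-<; +-monoʳ-<; *-monoˡ-≤-nonNeg; *-monoʳ-≤-nonNeg; *-monoˡ-<-pos; *-monoʳ-<-pos)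
  open ℚ-Solver using (solve; _:+_; _:*_; _:-_; :-_; _:=_; con)

  -- Vertex positions and separating lines

  -- Up to the factor 4 this is the linear map of order three that cycles (1, 0), (0, 1) and (-1,
  -- -1), the directions of the three rays.
  step : Point → Point
  step (x , y) = fromℕ 4 * - y , fromℕ 4 * (x - y)

  pt : ℕ → Point
  pt 0             = fromℕ 8 , 0ℚ
  pt 1             = fromℕ 6 , 1ℚ
  pt (suc (suc n)) = step (pt n)

  -- The linear form h takes the values a, b and c = - a - b on the unit vectors of the three rays.
  -- The bounds on a, b, c and g survive turn, and ensure that pt 0 and pt 1 lie below after a turn.
  record Support (u v : ℕ) : Set where
    field
      a b g : ℚ

    h : Point → ℚ
    h (x , y) = a * x + b * y

    field
      a≤3   : a ℚ.≤ fromℕ 3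
      b≤3   : b ℚ.≤ fromℕ 3
      c≤3   : - a - b ℚ.≤ fromℕ 3
      8≤g   : fromℕ 8 ℚ.≤ g
      at    : h (pt u) ≡ g
      above : g ℚ.< h (pt v)
      below : ∀ w → w ℕ.< v → w ≢ u → h (pt w) ℚ.< g

  -- The new form composed with `step` is 4 times the old one, so the conditions at translated
  -- vertices scale by 4, while the values on the three rays are permuted cyclically.
  turn : ∀ {u v} → Support u v → Support (2 ℕ.+ u) (2 ℕ.+ v)
  turn {u} {v} S = record
    { a = - a - b ; b = a ; g = fromℕ 4 * g
    ; a≤3 = c≤3 ; b≤3 = a≤3
    ; c≤3 = subst (ℚ._≤ fromℕ 3)
        (solve 2 (λ a b → b := :- (:- a :- b) :- a) refl a b) b≤3
    ; 8≤g = ≤-trans (toWitness {a? = fromℕ 8 ℚ.≤? fromℕ 32} _) 32≤4g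
    ; at = trans (h-step (pt u)) (cong (fromℕ 4 *_) at)
    ; above = subst (fromℕ 4 * g ℚ.<_) (sym (h-step (pt v)))
        (*-monoʳ-<-pos (fromℕ 4) above)
    ; below = below′
    }
    where
    open Support S
    h′ : Point → ℚ
    h′ (x , y) = (- a - b) * x + a * y
    h-step : ∀ p → h′ (step p) ≡ fromℕ 4 * h p
    h-step (x , y) = solve 4
      (λ a b x y → (:- a :- b) :* (con (fromℕ 4) :* :- y) :+ a :* (con (fromℕ 4) :* (x :- y))
                := con (fromℕ 4) :* (a :* x :+ b :* y)) refl a b x y
    32≤4g : fromℕ 32 ℚ.≤ fromℕ 4 * g
    32≤4g = *-monoˡ-≤-nonNeg (fromℕ 4) 8≤g
    -- Only `pt 0` and `pt 1` are not images of earlier points under `step`. Their coordinates are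
    -- nonnegative and the new coefficients are at most 3, so the form is at most 24 and 21 there,
    -- below 32.
    near-origin : ∀ x y .{{_ : ℚ.NonNegative x}} .{{_ : ℚ.NonNegative y}} →
      fromℕ 3 * x + fromℕ 3 * y ℚ.< fromℕ 32 → h′ (x , y) ℚ.< fromℕ 4 * g
    near-origin x y small =
      ≤-<-trans (+-mono-≤ (*-monoʳ-≤-nonNeg x c≤3) (*-monoʳ-≤-nonNeg y a≤3))
        (<-≤-trans small 32≤4g)
    below′ : ∀ w → w ℕ.< 2 ℕ.+ v → w ≢ 2 ℕ.+ u → h′ (pt w) ℚ.< fromℕ 4 * g
    below′ 0 _ _ = near-origin (fromℕ 8) 0ℚ (toWitness {a? = fromℕ 24 ℚ.<? fromℕ 32} _)
    below′ 1 _ _ = near-origin (fromℕ 6) 1ℚ (toWitness {a? = fromℕ 21 ℚ.<? fromℕ 32} _)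
    below′ (suc (suc w)) (s≤s (s≤s w<v)) w≢u =
      subst (ℚ._< fromℕ 4 * g) (sym (h-step (pt w)))
        (*-monoʳ-<-pos (fromℕ 4) (below w w<v (λ w≡u → w≢u (cong (2 ℕ.+_) w≡u))))

  -- All conditions compare explicit rationals, so for concrete arguments they are settled by
  -- evaluating the decision procedure.
  base : ∀ n a b g →
    let h = λ (p : Point) → a * proj₁ p + b * proj₂ p in
    {_ : True ((a ℚ.≤? fromℕ 3) ×-dec (b ℚ.≤? fromℕ 3) ×-dec (- a - b ℚ.≤? fromℕ 3) ×-dec
               (fromℕ 8 ℚ.≤? g) ×-dec (h (pt 0) ℚₚ.≟ g) ×-dec (g ℚ.<? h (pt (suc n))) ×-dec
               ℕₚ.allUpTo? (λ w → h (pt (suc w)) ℚ.<? g) n)} →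
    Support 0 (suc n)
  base n a b g {decided} =
    let a≤3 , b≤3 , c≤3 , 8≤g , at , above , below = toWitness decided in record
      { a = a ; b = b ; g = g ; a≤3 = a≤3 ; b≤3 = b≤3 ; c≤3 = c≤3 ; 8≤g = 8≤g
      ; at = at ; above = above
      ; below = λ { zero _ 0≢0 → contradiction refl 0≢0 ; (suc w) (s≤s w<n) _ → below w<n } }

  -- By translation it suffices to give lines for the four edges from x_0 to later vertices; d_0 has
  -- no later neighbour.
  support : ∀ u v → T (near u v) → u ℕ.< v → Support u v
  support 0 1 _ _ = base 0 1ℚ (fromℕ 3) (fromℕ 8)
  support 0 2 _ _ = base 1 1ℚ 1ℚ (fromℕ 8)
  support 0 4 _ _ = base 3 1ℚ (- fromℕ 2) (fromℕ 8)
  support 0 6 _ _ = base 5 (fromℕ 2) (- 1ℚ) (fromℕ 16)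
  support (suc (suc u)) (suc (suc v)) uv (s≤s (s≤s u<v)) = turn (support u v uv u<v)
  support 1 1 () _
  support 1 (suc (suc v)) () _

  -- Convex combinations

  mix : ℚ → ℚ → ℚ → ℚ
  mix t x y = (1ℚ - t) * x + t * y

  mix-same : ∀ t x → mix t x x ≡ x
  mix-same = solve 2 (λ t x → (con 1ℚ :- t) :* x :+ t :* x := x) refl

  mix-0 : ∀ x y → mix 0ℚ x y ≡ x
  mix-0 = solve 2 (λ x y → (con 1ℚ :- con 0ℚ) :* x :+ con 0ℚ :* y := x) refl

  mix-1 : ∀ x y → mix 1ℚ x y ≡ y
  mix-1 = solve 2 (λ x y → (con 1ℚ :- con 1ℚ) :* x :+ con 1ℚ :* y := y) refl

  -- Here `t` occurs only once, which makes monotonicity in `t` visible.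
  mix-affine : ∀ t x y → x + t * (y - x) ≡ mix t x y
  mix-affine = solve 3 (λ t x y → x :+ t :* (y :- x) := (con 1ℚ :- t) :* x :+ t :* y) refl

  p≤q⇒0≤q-p : ∀ {p q} → p ℚ.≤ q → 0ℚ ℚ.≤ q - p
  p≤q⇒0≤q-p {p} {q} p≤q = subst (ℚ._≤ q - p) (+-inverseʳ p) (+-monoˡ-≤ (- p) p≤q)

  p<q⇒0<q-p : ∀ {p q} → p ℚ.< q → 0ℚ ℚ.< q - p
  p<q⇒0<q-p {p} {q} p<q = subst (ℚ._< q - p) (+-inverseʳ p) (+-monoˡ-< (- p) p<q)

  mix-≤ : ∀ {t x y z} → 0ℚ ℚ.≤ t → t ℚ.≤ 1ℚ → x ℚ.≤ z → y ℚ.≤ z → mix t x y ℚ.≤ z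
  mix-≤ {t} {x} {y} {z} 0≤t t≤1 x≤z y≤z = subst (mix t x y ℚ.≤_) (mix-same t z)
    (+-mono-≤ (*-monoˡ-≤-nonNeg (1ℚ - t) {{ℚ.nonNegative (p≤q⇒0≤q-p t≤1)}} x≤z)
              (*-monoˡ-≤-nonNeg t {{ℚ.nonNegative 0≤t}} y≤z))

  -- Adding strict inequalities termwise would fail where a weight is 0; instead the combination is
  -- bounded by the larger of `x` and `y`.
  mix-< : ∀ {t x y z} → 0ℚ ℚ.≤ t → t ℚ.≤ 1ℚ → x ℚ.< z → y ℚ.< z → mix t x y ℚ.< z
  mix-< {x = x} {y} 0≤t t≤1 x<z y<z with ≤-total x y
  ... | inj₁ x≤y = ≤-<-trans (mix-≤ 0≤t t≤1 x≤y ≤-refl) y<z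
  ... | inj₂ y≤x = ≤-<-trans (mix-≤ 0≤t t≤1 ≤-refl y≤x) x<z

  mix-monoˡ-≤ : ∀ {s t x y} → x ℚ.< y → s ℚ.≤ t → mix s x y ℚ.≤ mix t x y
  mix-monoˡ-≤ {s} {t} {x} {y} x<y s≤t = subst₂ ℚ._≤_ (mix-affine s x y) (mix-affine t x y)
    (+-monoʳ-≤ x (*-monoʳ-≤-nonNeg (y - x) {{ℚ.nonNegative (<⇒≤ (p<q⇒0<q-p x<y))}} s≤t))

  mix-monoˡ-< : ∀ {s t x y} → x ℚ.< y → s ℚ.< t → mix s x y ℚ.< mix t x y
  mix-monoˡ-< {s} {t} {x} {y} x<y s<t = subst₂ ℚ._<_ (mix-affine s x y) (mix-affine t x y)
    (+-monoʳ-< x (*-monoˡ-<-pos (y - x) {{ℚ.positive (p<q⇒0<q-p x<y)}} s<t))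

  mix-monoᵐ-< : ∀ {t x x′ y} → t ℚ.< 1ℚ → x ℚ.< x′ → mix t x y ℚ.< mix t x′ y
  mix-monoᵐ-< {t} {y = y} t<1 x<x′ =
    +-monoˡ-< (t * y) (*-monoʳ-<-pos (1ℚ - t) {{ℚ.positive (p<q⇒0<q-p t<1)}} x<x′)

  mixᵖ : ℚ → Point → Point → Point
  mixᵖ t (x , y) (x′ , y′) = mix t x x′ , mix t y y′

  mixᵖ-0 : ∀ p q → mixᵖ 0ℚ p q ≡ p
  mixᵖ-0 (x , y) (x′ , y′) = cong₂ _,_ (mix-0 x x′) (mix-0 y y′)

  mixᵖ-1 : ∀ p q → mixᵖ 1ℚ p q ≡ q
  mixᵖ-1 (x , y) (x′ , y′) = cong₂ _,_ (mix-1 x x′) (mix-1 y y′)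

  start-on : ∀ p q → OnSegment p q p
  start-on p q = 0ℚ , ≤-refl , toWitness {a? = 0ℚ ℚ.≤? 1ℚ} _ , sym (mixᵖ-0 p q)

  end-on : ∀ p q → OnSegment p q q
  end-on p q = 1ℚ , toWitness {a? = 0ℚ ℚ.≤? 1ℚ} _ , ≤-refl , sym (mixᵖ-1 p q)

  -- Intersections of edges

  module SupportProperties {u v} (S : Support u v) where
    open Support S public

    h-mix : ∀ t p q → h (mixᵖ t p q) ≡ mix t (h p) (h q)
    h-mix t (x , y) (x′ , y′) = solve 7
      (λ a b t x y x′ y′ →
        a :* ((con 1ℚ :- t) :* x :+ t :* x′) :+ b :* ((con 1ℚ :- t) :* y :+ t :* y′) :=
        (con 1ℚ :- t) :* (a :* x :+ b :* y) :+ t :* (a :* x′ :+ b :* y′))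
      refl a b t x y x′ y′

    h-mix-u : ∀ t q → h (mixᵖ t (pt u) q) ≡ mix t g (h q)
    h-mix-u t q = trans (h-mix t (pt u) q) (cong (λ z → mix t z (h q)) at)

    below-≤ : ∀ w → w ℕ.< v → h (pt w) ℚ.≤ g
    below-≤ w w<v with w ℕₚ.≟ u
    ... | yes refl = ≤-reflexive at
    ... | no w≢u   = <⇒≤ (below w w<v w≢u)

  -- The line h = g through pt c has the segment ab on one side, touching it at most at pt c, and pt d on the other.
  meets-later : ∀ {a b c d p} → Support c d → a ℕ.< d → b ℕ.< d →
    OnSegment (pt a) (pt b) p → OnSegment (pt c) (pt d) p →
    p ≡ pt c × (p ≡ pt a ⊎ p ≡ pt b)
  meets-later {a} {b} {c} {d} {p} S a<d b<d (t , 0≤t , t≤1 , p≡ab) (s , 0≤s , s≤1 , p≡cd) =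
    p≡c , at-end (c ℕₚ.≟ a) (c ℕₚ.≟ b)
    where
    open SupportProperties S hiding (a; b)
    h-ab : h p ≡ mix t (h (pt a)) (h (pt b))
    h-ab = trans (cong h p≡ab) (h-mix t (pt a) (pt b))
    h-cd : h p ≡ mix s g (h (pt d))
    h-cd = trans (cong h p≡cd) (h-mix-u s (pt d))
    s≯0 : ¬ (0ℚ ℚ.< s)
    s≯0 0<s = <-irrefl refl (<-≤-trans
      (subst₂ ℚ._<_ (mix-0 g (h (pt d))) (sym h-cd) (mix-monoˡ-< above 0<s))
      (subst (ℚ._≤ g) (sym h-ab) (mix-≤ 0≤t t≤1 (below-≤ a a<d) (below-≤ b b<d))))
    p≡c : p ≡ pt c
    p≡c = trans p≡cd (trans (cong (λ r → mixᵖ r (pt c) (pt d)) (≤-antisym (≮⇒≥ s≯0) 0≤s))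
                            (mixᵖ-0 (pt c) (pt d)))
    at-end : Dec (c ≡ a) → Dec (c ≡ b) → p ≡ pt a ⊎ p ≡ pt b
    at-end (yes refl) _ = inj₁ p≡c
    at-end _ (yes refl) = inj₂ p≡c
    at-end (no c≢a) (no c≢b) = contradiction (trans (cong h p≡c) at)
      (<⇒≢ (subst (ℚ._< g) (sym h-ab) (mix-< 0≤t t≤1 (below a a<d (λ a≡c → c≢a (sym a≡c)))
                                                  (below b b<d (λ b≡c → c≢b (sym b≡c))))))

  -- The form is `g` at `pt a` and smaller at `pt c`. At equal parameters below 1 the point coming
  -- from `pt c` thus has the smaller value, so it must be further along towards `pt d` to reach the
  -- common point.
  mix-parameter-< : ∀ {a c d p} s t → Support a d → c ℕ.< d → c ≢ a → s ℚ.< 1ℚ →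
    p ≡ mixᵖ t (pt a) (pt d) → p ≡ mixᵖ s (pt c) (pt d) → t ℚ.< s
  mix-parameter-< {a} {c} {d} {p} s t S c<d c≢a s<1 p≡ad p≡cd = ≰⇒> λ s≤t →
    <-irrefl refl (<-≤-trans
      (subst (ℚ._< mix s g (h (pt d)))
        (trans (sym (h-mix s (pt c) (pt d))) (trans (cong h (trans (sym p≡cd) p≡ad)) (h-mix-u t (pt d))))
        (mix-monoᵐ-< s<1 (below c c<d c≢a)))
      (mix-monoˡ-≤ above s≤t))
    where open SupportProperties S hiding (a; b)

  -- If `s` were below 1, the separating lines of the two edges would give both `t < s` and `s < t`.
  meets-at-top : ∀ {a c d p} → Support a d → Support c d → a ℕ.< d → c ℕ.< d → a ≢ c →
    OnSegment (pt a) (pt d) p → OnSegment (pt c) (pt d) p → p ≡ pt d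
  meets-at-top {a} {c} {d} {p} Sa Sc a<d c<d a≢c (t , 0≤t , t≤1 , p≡ad) (s , 0≤s , s≤1 , p≡cd) =
    trans p≡cd (trans (cong (λ r → mixᵖ r (pt c) (pt d)) (≤-antisym s≤1 (≮⇒≥ s≮1))) (mixᵖ-1 (pt c) (pt d)))
    where
    s≮1 : ¬ (s ℚ.< 1ℚ)
    s≮1 s<1 =
      let t<s = mix-parameter-< s t Sa c<d (λ c≡a → a≢c (sym c≡a)) s<1 p≡ad p≡cd
          s<t = mix-parameter-< t s Sc a<d a≢c (<-≤-trans t<s s≤1) p≡cd p≡ad
      in <-irrefl refl (≤-<-trans (<⇒≤ t<s) s<t)

  -- The edge whose larger end comes later is separated from the other by its own line; edges with
  -- the same larger end can meet only there.
  meet-at-ends : ∀ {a b c d p} → T (near a b) → a ℕ.< b → T (near c d) → c ℕ.< d →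
    (a , b) ≢ (c , d) → OnSegment (pt a) (pt b) p → OnSegment (pt c) (pt d) p →
    p ≡ pt a ⊎ p ≡ pt b
  meet-at-ends {a} {b} {c} {d} ab a<b cd c<d ab≢cd p∈ab p∈cd with ℕₚ.<-cmp b d
  ... | tri< b<d _ _ = proj₂ (meets-later (support c d cd c<d) (ℕₚ.<-trans a<b b<d) b<d p∈ab p∈cd)
  ... | tri≈ _ refl _ = inj₂ (meets-at-top (support a b ab a<b) (support c b cd c<d) a<b c<d
                                (λ { refl → ab≢cd refl }) p∈ab p∈cd)
  ... | tri> _ _ d<b = inj₁ (proj₁ (meets-later (support a b ab a<b) (ℕₚ.<-trans c<d d<b) d<b p∈cd p∈ab))

  -- Vertices off the edges, and the drawing

  parent : ∀ v → ∃[ u ] (T (near u (suc v)) × u ℕ.< suc v)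
  parent 0 = 0 , tt , s≤s z≤n
  parent 1 = 0 , tt , s≤s z≤n
  parent (suc (suc v)) =
    let u , uv , u<v = parent v in suc (suc u) , uv , s≤s (s≤s u<v)

  -- Since no vertex is isolated, a vertex lying on an edge is a meeting point of edges, so
  -- `meet-at-ends` applies to it.
  incident : ∀ w → ∃[ u ] ∃[ v ] (T (near u v) × u ℕ.< v × (w ≡ u ⊎ w ≡ v))
  incident zero    = 0 , 1 , tt , s≤s z≤n , inj₁ refl
  incident (suc w) = let u , uw , u<w = parent w in u , suc w , uw , u<w , inj₂ refl

  -- A line supporting an edge from an earlier vertex to `v` has `pt v` strictly above it and every
  -- earlier point on or below it.
  pt-<-≢ : ∀ {u v} → u ℕ.< v → pt u ≢ pt v
  pt-<-≢ {u} {suc v} u<v eq =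
    let w , wv , w<v = parent v
        open SupportProperties (support w (suc v) wv w<v)
    in <-irrefl (cong h eq) (≤-<-trans (below-≤ u u<v) above)

  pt-injective : ∀ u v → pt u ≡ pt v → u ≡ v
  pt-injective u v eq with ℕₚ.<-cmp u v
  ... | tri< u<v _ _ = contradiction eq (pt-<-≢ u<v)
  ... | tri≈ _ u≡v _ = u≡v
  ... | tri> _ _ v<u = contradiction (sym eq) (pt-<-≢ v<u)

  pt-off-edges : ∀ {u v} → T (near u v) → u ℕ.< v → ∀ w → OnSegment (pt u) (pt v) (pt w) →
    pt w ≡ pt u ⊎ pt w ≡ pt v
  pt-off-edges {u} {v} uv u<v w on with incident w
  ... | a , b , ab , a<b , w-end with (u ℕₚ.≟ a) ×-dec (v ℕₚ.≟ b)
  ...   | yes (refl , refl) = [ (λ e → inj₁ (cong pt e)) , (λ e → inj₂ (cong pt e)) ]′ w-end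
  ...   | no uv≢ab = meet-at-ends uv u<v ab a<b (λ { refl → uv≢ab (refl , refl) }) on (on′ w-end)
    where
    on′ : w ≡ a ⊎ w ≡ b → OnSegment (pt a) (pt b) (pt w)
    on′ (inj₁ refl) = start-on (pt a) (pt b)
    on′ (inj₂ refl) = end-on (pt a) (pt b)

  drawing : ∀ n → PlaneDrawing (graph n)
  drawing n = record
    { pos             = λ u → pt (toℕ u)
    ; bends           = λ _ _ → []
    ; pos-injective   = λ u v eq → toℕ-injective (pt-injective _ _ eq)
    ; edges-arcs      = λ u v (u<v , _) eq → ℕₚ.<⇒≢ u<v (pt-injective _ _ eq)
    ; avoids-vertices = λ { u v (u<v , uv) p (on , p≢u , p≢v) w refl →
        [ p≢u , p≢v ]′ (pt-off-edges uv u<v (toℕ w) on) }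
    ; avoids-edges    = λ u v u′ v′ (u<v , uv) (u′<v′ , u′v′) e≢e′ p (on , p≢u , p≢v) on′ →
        [ p≢u , p≢v ]′ (meet-at-ends uv u<v u′v′ u′<v′
          (λ eq → e≢e′ (cong₂ _,_ (toℕ-injective (cong proj₁ eq)) (toℕ-injective (cong proj₂ eq))))
          on on′)
    }

module Counting where

  open Data.Nat using (_+_; _*_; _∸_; _≤?_)
  open Data.Fin.Subset using (_-_)
  open ℕₚ using (+-0-commutativeMonoid; +-assoc; +-identityʳ; *-identityʳ; +-mono-≤; ≤-trans; ≤-reflexive; m≤m+n; m≤n+m; m+n∸m≡n)
  open Algebra.Properties.CommutativeMonoid.Sum +-0-commutativeMonoid using (sum; sum-cong-≗; sum-replicate-zero)
  open ℕ-Solver using (solve; _:+_; _:*_; _:=_; con)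

  -- Cardinalities as sums

  indicator : Bool → ℕ
  indicator b = if b then 1 else 0

  ∣∣≡sum : ∀ {n} (p : Subset n) → ∣ p ∣ ≡ sum (λ i → indicator (lookup p i))
  ∣∣≡sum []            = refl
  ∣∣≡sum (inside ∷ p)  = cong suc (∣∣≡sum p)
  ∣∣≡sum (outside ∷ p) = ∣∣≡sum p

  ∣subset∣ : ∀ {n ℓ} {P : Fin n → Set ℓ} (P? : U.Decidable P) →
    ∣ subset P? ∣ ≡ sum (λ i → indicator (does (P? i)))
  ∣subset∣ P? = trans (∣∣≡sum (subset P?))
    (sum-cong-≗ (λ i → cong indicator (lookup∘tabulate (does ∘ P?) i)))

  ∈-subset⁺ : ∀ {n ℓ} {P : Fin n → Set ℓ} (P? : U.Decidable P) {i} → P i → i ∈ subset P?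
  ∈-subset⁺ P? {i} Pi =
    lookup⇒[]= i _ (trans (lookup∘tabulate (does ∘ P?) i) (dec-true (P? i) Pi))

  ∈-subset⁻ : ∀ {n ℓ} {P : Fin n → Set ℓ} (P? : U.Decidable P) {i} → i ∈ subset P? → P i
  ∈-subset⁻ P? {i} i∈ with P? i | trans (sym (lookup∘tabulate (does ∘ P?) i)) ([]=⇒lookup i∈)
  ... | yes Pi | _ = Pi

  -- The enumeration `g` is arbitrary so that the induction can pass to `g ∘ suc`.
  sum-filter : ∀ {n} {A : Set} {P : A → Set} (P? : U.Decidable P) (f : A → ℕ) (g : Fin n → A) →
    sumᴸ (List.map f (filter P? (List.tabulate g))) ≡
    sum (λ i → if does (P? (g i)) then f (g i) else 0)
  sum-filter {zero}  P? f g = refl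
  sum-filter {suc n} P? f g with P? (g zero)
  ... | yes _ = cong (λ s → f (g zero) + s) (sum-filter P? f (g ∘ suc))
  ... | no  _ = sum-filter P? f (g ∘ suc)

  i∉p-i : ∀ {n} (p : Subset n) i → i ∉ p - i
  i∉p-i (_ ∷ p) (suc i) (there i∈) = i∉p-i p i i∈

  -- Hubs, leaves and owners

  -- hub i is x_i and leaf i is d_i.
  hub leaf : ∀ {q} → Fin q → Fin (q * 2)
  hub zero    = zero
  hub (suc i) = suc (suc (hub i))
  leaf zero    = suc zero
  leaf (suc i) = suc (suc (leaf i))

  data View q : Fin (q * 2) → Set where
    at-hub : (i : Fin q) → View q (hub i)
    at-leaf : (i : Fin q) → View q (leaf i)

  view : ∀ q (v : Fin (q * 2)) → View q v
  view (suc q) zero = at-hub zero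
  view (suc q) (suc zero) = at-leaf zero
  view (suc q) (suc (suc v)) with view q v
  ... | at-hub i = at-hub (suc i)
  ... | at-leaf i = at-leaf (suc i)

  sum-pairs : ∀ q (f : Fin (q * 2) → ℕ) → sum f ≡ sum {q} (λ i → f (hub i) + f (leaf i))
  sum-pairs zero    f = refl
  sum-pairs (suc q) f = trans (sym (+-assoc (f zero) (f (suc zero)) _))
    (cong (λ s → f zero + f (suc zero) + s) (sum-pairs q (λ v → f (suc (suc v)))))

  leaves : ∀ q → Subset (q * 2)
  leaves zero    = []
  leaves (suc q) = outside ∷ inside ∷ leaves q

  ∣leaves∣ : ∀ q → ∣ leaves q ∣ ≡ q
  ∣leaves∣ zero    = refl
  ∣leaves∣ (suc q) = cong suc (∣leaves∣ q)

  leaf∈leaves : ∀ {q} (i : Fin q) → leaf i ∈ leaves q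
  leaf∈leaves zero    = there here
  leaf∈leaves (suc i) = there (there (leaf∈leaves i))

  hub∉leaves : ∀ {q} (i : Fin q) → hub i ∉ leaves q
  hub∉leaves (suc i) (there (there xi∈)) = hub∉leaves i xi∈

  owner : ∀ q → Fin (q * 2) → Fin (q * 2)
  owner (suc q) zero          = suc zero
  owner (suc q) (suc zero)    = suc zero
  owner (suc q) (suc (suc v)) = suc (suc (owner q v))

  owner-hub : ∀ {q} (i : Fin q) → owner q (hub i) ≡ leaf i
  owner-hub zero    = refl
  owner-hub (suc i) = cong (λ v → suc (suc v)) (owner-hub i)

  owner-leaf : ∀ {q} (i : Fin q) → owner q (leaf i) ≡ leaf i
  owner-leaf zero    = refl
  owner-leaf (suc i) = cong (λ v → suc (suc v)) (owner-leaf i)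

  leaf-injective : ∀ {q} {i j : Fin q} → leaf i ≡ leaf j → i ≡ j
  leaf-injective {i = zero}  {zero}  _  = refl
  leaf-injective {i = zero}  {suc j} ()
  leaf-injective {i = suc i} {zero}  ()
  leaf-injective {i = suc i} {suc j} eq = cong suc (leaf-injective (suc-injective (suc-injective eq)))

  near-hub-leaf : ∀ {q} (i j : Fin q) → T (near (toℕ (hub i)) (toℕ (leaf j))) → i ≡ j
  near-hub-leaf zero    zero    _  = refl
  near-hub-leaf zero    (suc j) a = contradiction a (odd j)
    where
    -- The number of a leaf is odd, and 1 is the only odd number at which `near₀` is true. Three
    -- case splits carry the argument past 6, where the last clause of `near₀` applies.
    odd : ∀ {q} (j : Fin q) → ¬ T (near 0 (2 + toℕ (leaf j)))
    odd zero ()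
    odd (suc zero) ()
    odd (suc (suc zero)) ()
    odd (suc (suc (suc j))) ()
  near-hub-leaf (suc i) (suc j) a = cong suc (near-hub-leaf i j a)

  near-leaf-leaf : ∀ {q} (i j : Fin q) → ¬ T (near (toℕ (leaf i)) (toℕ (leaf j)))
  near-leaf-leaf zero    zero    ()
  near-leaf-leaf zero    (suc j) ()
  near-leaf-leaf (suc i) zero    ()
  near-leaf-leaf (suc i) (suc j) = near-leaf-leaf i j

  near-own : ∀ {q} (i : Fin q) → T (near (toℕ (hub i)) (toℕ (leaf i)))
  near-own zero    = tt
  near-own (suc i) = near-own i

  -- Domination and the values of k

  module _ (q : ℕ) where
    corona : Graph (q * 2)
    corona = graph (q * 2)
    open Graph corona using (Adj; adj?)

    assignment : OwnerAssignment corona (leaves q)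
    assignment = record { m = owner q ; m∈D = m∈D ; m-fixes = fixes ; m-adj = adj }
      where
      m∈D : ∀ v → owner q v ∈ leaves q
      m∈D v with view q v
      ... | at-hub i = subst (_∈ leaves q) (sym (owner-hub i)) (leaf∈leaves i)
      ... | at-leaf i = subst (_∈ leaves q) (sym (owner-leaf i)) (leaf∈leaves i)
      fixes : ∀ v → v ∈ leaves q → owner q v ≡ v
      fixes v v∈D with view q v
      ... | at-hub i = contradiction v∈D (hub∉leaves i)
      ... | at-leaf i = owner-leaf i
      adj : ∀ v → ¬ v ∈ leaves q → Adj v (owner q v)
      adj v v∉D with view q v
      ... | at-hub i = subst (Adj (hub i)) (sym (owner-hub i)) (near-own i)
      ... | at-leaf i = contradiction (leaf∈leaves i) v∉D

    dominating : IsDominating corona (leaves q)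
    dominating v with view q v
    ... | at-hub i = inj₂ (leaf i , leaf∈leaves i , near-own i)
    ... | at-leaf i = inj₁ (leaf∈leaves i)

    -- The pairs of `hub i` and `leaf i` partition the vertices, and each pair is the closed
    -- neighbourhood of its leaf, so every dominating set meets all `q` of them.
    minimum : IsMinimumDominating corona (leaves q)
    minimum = dominating , λ D′ dom → begin
      ∣ leaves q ∣                                ≡⟨ ∣leaves∣ q ⟩
      q                                           ≤⟨ ≤-sum _ (meets D′ dom) ⟩
      sum {q} (λ i → indicator (lookup D′ (hub i)) + indicator (lookup D′ (leaf i)))
                                                  ≡⟨ sum-pairs q _ ⟨
      sum (λ v → indicator (lookup D′ v))         ≡⟨ ∣∣≡sum D′ ⟨
      ∣ D′ ∣                                      ∎
      where
      open ℕₚ.≤-Reasoning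
      ≤-sum : ∀ {n} (f : Fin n → ℕ) → (∀ i → 1 ≤ f i) → n ≤ sum f
      ≤-sum {zero}  f 1≤f = z≤n
      ≤-sum {suc n} f 1≤f = +-mono-≤ (1≤f zero) (≤-sum (f ∘ suc) (1≤f ∘ suc))
      member : ∀ D′ {v : Fin (q * 2)} → v ∈ D′ → 1 ≤ indicator (lookup D′ v)
      member D′ v∈D′ = ≤-reflexive (cong indicator (sym ([]=⇒lookup v∈D′)))
      meets : ∀ D′ → IsDominating corona D′ → ∀ (i : Fin q) →
        1 ≤ indicator (lookup D′ (hub i)) + indicator (lookup D′ (leaf i))
      meets D′ dom i with dom (leaf i)
      ... | inj₁ di∈D′ = ≤-trans (member D′ di∈D′) (m≤n+m _ _)
      ... | inj₂ (v , v∈D′ , div) with view q v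
      ...   | at-leaf j = contradiction div (near-leaf-leaf i j)
      ...   | at-hub j with near-hub-leaf j i (Graph.sym corona {leaf i} {hub j} div)
      ...     | refl = ≤-trans (member D′ v∈D′) (m≤m+n _ _)

    -- The vertex is a bare number, so that it can be translated independently of `q`.
    degree : ℕ → ℕ
    degree u = sum {q} (λ j → indicator (near u (toℕ (hub j))))

    -- The block of `leaf j` consists of `hub j` and `leaf j`. Apart from its own leaf, `hub i` has
    -- only hubs as neighbours, so it touches another block exactly when it is adjacent to the hub
    -- there.
    k-hub : ∀ i → k corona assignment (hub i) ≡ degree (toℕ (hub i))
    k-hub i = trans (∣subset∣ touches?) (trans (sum-pairs q _) (sum-cong-≗ (λ j →
      cong₂ (λ b b′ → indicator b + indicator b′)
        (dec-false (touches? (hub j)) (λ (xj∈ , _) → hub∉leaves j (p─q⊆p (leaves q) _ xj∈)))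
        (does-⇔ (mk⇔ (to j) (from j)) (touches? (leaf j)) (adj? (hub i) (hub j))))))
      where
      Touches : Fin (q * 2) → Set
      Touches c = c ∈ leaves q - owner q (hub i) × Nonempty (N corona (hub i) ∩ block corona assignment c)
      touches? : U.Decidable Touches
      touches? c = (c ∈? (leaves q - owner q (hub i))) ×-dec nonempty? (N corona (hub i) ∩ block corona assignment c)
      to : ∀ j → Touches (leaf j) → Adj (hub i) (hub j)
      to j (dj∈ , v , v∈) with x∈p∩q⁻ (N corona (hub i)) _ v∈
      ... | v∈N , v∈B with ∈-subset⁻ (adj? (hub i)) {v} v∈N | ∈-subset⁻ (λ u → owner q u ≟ leaf j) {v} v∈B
      ...   | iv | mv≡dj with view q v
      ...     | at-hub l = subst (λ l → Adj (hub i) (hub l)) (leaf-injective (trans (sym (owner-hub l)) mv≡dj)) iv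
      -- A leaf adjacent to `hub i` is its owner, whose block `k` leaves out.
      ...     | at-leaf l with near-hub-leaf i l iv
      ...       | refl = contradiction
        (subst (_∈ leaves q - owner q (hub i)) (trans (sym mv≡dj) (trans (owner-leaf i) (sym (owner-hub i)))) dj∈)
        (i∉p-i (leaves q) (owner q (hub i)))
      from : ∀ j → Adj (hub i) (hub j) → Touches (leaf j)
      from j ij =
        x∈p∧x≢y⇒x∈p-y (leaf∈leaves j) (λ eq → Graph.irrefl corona {hub i} {hub j}
          (cong hub (sym (leaf-injective (trans eq (owner-hub i))))) ij) ,
        hub j , x∈p∩q⁺ (∈-subset⁺ (adj? (hub i)) ij , ∈-subset⁺ (λ v → owner q v ≟ leaf j) (owner-hub j))

  -- Sums over the degrees, and the sizes of W and A

  total : (ℕ → ℕ) → ℕ → ℕ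
  total F q = sum {q} (λ i → F (degree q (toℕ (hub i))))

  -- After earlier hubs are split off, this also counts the neighbours ahead of any hub that has at
  -- least three hubs after it.
  degree-0 : ∀ m → degree (4 + m) 0 ≡ 3
  degree-0 m = cong (λ e → 3 + e) (sum-replicate-zero m)

  -- The summands of total F (3 + m) from the fourth on, so that increasing m adds a summand in front.
  inner : (ℕ → ℕ) → ℕ → ℕ
  inner F m = sum {m} (λ i → F (degree (3 + m) (6 + toℕ (hub i))))

  -- In the induction step the first summand has three neighbours on either side. The later ones are
  -- not adjacent to the first hub of the path, and dropping that hub leaves the sum for `n`.
  inner-formula : ∀ F n → inner F (3 + n) ≡ n * F 6 + (F 3 + F 4 + F 5)
  inner-formula F zero    = solve 3 (λ a b c → c :+ (b :+ (a :+ con 0)) := con 0 :+ (a :+ b :+ c)) refl (F 3) (F 4) (F 5)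
  inner-formula F (suc n) = trans
    (cong₂ _+_ (cong (λ e → F (3 + e)) (degree-0 n)) (inner-formula F n))
    (sym (+-assoc (F 6) (n * F 6) _))

  -- The first three hubs have three neighbours ahead and 0, 1, 2 behind.
  total-formula : ∀ F n → total F (6 + n) ≡ F 3 + F 4 + F 5 + (n * F 6 + (F 3 + F 4 + F 5))
  total-formula F n = trans
    (cong₂ _+_ (cong F (degree-0 (2 + n)))
      (cong₂ _+_ (cong (λ e → F (1 + e)) (degree-0 (1 + n)))
        (cong₂ _+_ (cong (λ e → F (2 + e)) (degree-0 n)) (inner-formula F n))))
    (solve 4 (λ a b c e → a :+ (b :+ (c :+ e)) := a :+ b :+ c :+ e) refl (F 3) (F 4) (F 5) _)

  W-total : ∀ q → W (corona q) (assignment q) ≡ total (_∸ 2) q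
  W-total q = trans (sum-filter (λ v → ¬? (v ∈? leaves q)) (λ v → k (corona q) (assignment q) v ∸ 2) (λ v → v))
    (trans (sum-pairs q _) (sum-cong-≗ (λ i → trans
      (cong₂ (λ b b′ → (if b then k (corona q) (assignment q) (hub i) ∸ 2 else 0)
                     + (if b′ then k (corona q) (assignment q) (leaf i) ∸ 2 else 0))
        (dec-true (¬? (hub i ∈? leaves q)) (hub∉leaves i))
        (dec-false (¬? (leaf i ∈? leaves q)) (λ d∉ → d∉ (leaf∈leaves i))))
      (trans (+-identityʳ _) (cong (_∸ 2) (k-hub q i))))))

  A-total : ∀ q → ∣ A (corona q) (assignment q) ∣ ≡ total (λ e → indicator (does (6 ≤? e))) q
  A-total q = trans (∣subset∣ inA?) (trans (sum-pairs q _) (sum-cong-≗ (λ i → trans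
    (cong₂ (λ b b′ → indicator b + indicator b′)
      (trans (cong (_∧ does (6 ≤? k (corona q) (assignment q) (hub i)))
                   (dec-true (¬? (hub i ∈? leaves q)) (hub∉leaves i)))
             (cong (λ e → does (6 ≤? e)) (k-hub q i)))
      (dec-false (inA? (leaf i)) (λ (d∉ , _) → d∉ (leaf∈leaves i))))
    (+-identityʳ _))))
    where
    inA? = λ v → ¬? (v ∈? leaves q) ×-dec (6 ≤? k (corona q) (assignment q) v)

  ∣A∣≡ : ∀ n → ∣ A (corona (6 + n)) (assignment (6 + n)) ∣ ≡ n
  ∣A∣≡ n = trans (A-total (6 + n)) (trans (total-formula (λ e → indicator (does (6 ≤? e))) n)
    (trans (+-identityʳ _) (*-identityʳ n)))

  W≡ : ∀ n → W (corona (6 + n)) (assignment (6 + n)) ≡ 12 + n * 4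
  W≡ n = trans (W-total (6 + n)) (trans (total-formula (_∸ 2) n)
    -- At either end the degrees 3, 4, 5 contribute 1 + 2 + 3 = 6.
    (solve 1 (λ n → con 6 :+ (n :* con 4 :+ con 6) := con 12 :+ n :* con 4) refl n))

  +m≡+[n+m]-+n : ∀ m n → + m ≡ + (n + m) ℤ.- + n
  +m≡+[n+m]-+n m n = sym (trans (ℤₚ.[+m]-[+n]≡m⊖n (n + m) n)
    (trans (ℤₚ.⊖-≥ (m≤m+n n m)) (cong +_ (m+n∸m≡n n m))))

  W-equation : ∀ {w s} n → w ≡ 12 + n * 4 → s ≡ 6 + n → + w ≡ + 4 ℤ.* + s ℤ.- + 12
  W-equation n refl refl = trans (+m≡+[n+m]-+n (12 + n * 4) 12) (cong (ℤ._- + 12)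
    (trans (cong +_ (solve 1 (λ n → con 12 :+ (con 12 :+ n :* con 4) := con 4 :* (con 6 :+ n)) refl n))
           (ℤₚ.pos-* 4 (6 + n))))

  A-equation : ∀ {a s} n → a ≡ n → s ≡ 6 + n → + a ≡ + s ℤ.- + 6
  A-equation n refl refl = +m≡+[n+m]-+n n 6

open Data.Nat using (_+_; _*_)
open ℕₚ using (≤-trans; *-monoʳ-≤; m≤n+m; m≤m⊔n; m≤n⊔m)
open ℚ-Solver using (solve; _:+_; _:*_; _:-_; :-_; _:=_; con)
open Drawing using (drawing)
open Counting

-- Naturals among the rationals

coprime-1 : ∀ a → Coprime a 1
coprime-1 a = Coprimality.sym (1-coprimeTo a)

-- The quotient `+ a / 1` is stuck on a gcd for variable `a`; the explicit fraction lets sums,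
-- products and comparisons compute.
fromℕ≡mkℚ : ∀ a → fromℕ a ≡ mkℚ (+ a) 0 (coprime-1 a)
fromℕ≡mkℚ a = ℚₚ.normalize-coprime (coprime-1 a)

fromℕ-+ : ∀ a b → fromℕ (a + b) ≡ fromℕ a ℚ.+ fromℕ b
fromℕ-+ a b = sym (trans (cong₂ ℚ._+_ (fromℕ≡mkℚ a) (fromℕ≡mkℚ b))
  (cong (ℚ._/ 1) (cong₂ ℤ._+_ (ℤₚ.*-identityʳ (+ a)) (ℤₚ.*-identityʳ (+ b)))))

fromℕ-* : ∀ a b → fromℕ (a * b) ≡ fromℕ a ℚ.* fromℕ b
fromℕ-* a b = sym (trans (cong₂ ℚ._*_ (fromℕ≡mkℚ a) (fromℕ≡mkℚ b))
  (cong (ℚ._/ 1) (sym (ℤₚ.pos-* a b))))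

fromℕ-mono-≤ : ∀ {a b} → a ≤ b → fromℕ a ℚ.≤ fromℕ b
fromℕ-mono-≤ {a} {b} a≤b = subst₂ ℚ._≤_ (sym (fromℕ≡mkℚ a)) (sym (fromℕ≡mkℚ b))
  (ℚ.*≤* (ℤₚ.*-monoʳ-≤-nonNeg (+ 1) (ℤ.+≤+ a≤b)))

fromℕ-nonNegative : ∀ a → ℚ.NonNegative (fromℕ a)
fromℕ-nonNegative a = ℚ.nonNegative {fromℕ a} (fromℕ-mono-≤ {0} {a} z≤n)

-- A positive fraction is at least the inverse of its denominator, which serves as `n`.
archimedean : ∀ ε → 0ℚ ℚ.< ε → ∃[ n ] 1ℚ ℚ.≤ ε ℚ.* fromℕ n
archimedean (mkℚ ℤ.+0 m c) (ℚ.*<* (ℤ.+<+ ()))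
archimedean ε@(mkℚ (+ suc l) m c) _ = suc m , subst (ℚ._≤ ε ℚ.* fromℕ (suc m))
  (trans (cong (ℚ.1/ r ℚ.*_) (fromℕ≡mkℚ (suc m))) (ℚₚ.*-inverseˡ r))
  (ℚₚ.*-monoʳ-≤-nonNeg (fromℕ (suc m)) {{fromℕ-nonNegative (suc m)}} 1/r≤ε)
  where
  r : ℚ
  r = mkℚ (+ suc m) 0 (coprime-1 (suc m))
  1/r≤ε : ℚ.1/ r ℚ.≤ ε
  1/r≤ε = ℚ.*≤* (ℤₚ.*-monoʳ-≤-nonNeg (+ suc m) (ℤ.+≤+ (s≤s (z≤n {l}))))

-- Smaller constants fail

-- With q = 6 + n the left side is at most q - εq - 2, hence at most q - 7 = n - 1, unless the
-- positive part is 0; then 1 < 2 ≤ n suffices.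
bound-too-small : ∀ c {ε} n → 0ℚ ℚ.< ε → c ℚ.+ ε ℚ.≤ 1ℚ → fromℕ 5 ℚ.≤ ε ℚ.* fromℕ n → 2 ≤ n →
  (c ℚ.* fromℕ (6 + n) ℚ.- fromℕ 3) ⁺ ℚ.+ 1ℚ ℚ.< fromℕ n
bound-too-small c {ε} n 0<ε c+ε≤1 5≤εn 2≤n with ℚₚ.⊔-sel (c ℚ.* fromℕ (6 + n) ℚ.- fromℕ 3) 0ℚ
... | inj₂ eq rewrite eq = ℚₚ.<-≤-trans (toWitness {a? = 1ℚ ℚ.<? fromℕ 2} _) (fromℕ-mono-≤ 2≤n)
... | inj₁ eq rewrite eq = begin-strict
    c ℚ.* q ℚ.- fromℕ 3 ℚ.+ 1ℚ
      ≡⟨ solve 3 (λ c ε q → c :* q :- con (fromℕ 3) :+ con 1ℚ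
           := (c :+ ε) :* q :+ (:- (ε :* q) :- con (fromℕ 2))) refl c ε q ⟩
    (c ℚ.+ ε) ℚ.* q ℚ.+ (ℚ.- (ε ℚ.* q) ℚ.- fromℕ 2)
      ≤⟨ ℚₚ.+-mono-≤ (ℚₚ.*-monoʳ-≤-nonNeg q {{0≤q}} c+ε≤1)
           (ℚₚ.+-monoˡ-≤ (ℚ.- fromℕ 2) (ℚₚ.neg-antimono-≤ 5≤εq)) ⟩
    1ℚ ℚ.* q ℚ.+ (ℚ.- fromℕ 5 ℚ.- fromℕ 2)
      ≡⟨ cong (λ q → 1ℚ ℚ.* q ℚ.+ (ℚ.- fromℕ 5 ℚ.- fromℕ 2)) (fromℕ-+ 6 n) ⟩
    1ℚ ℚ.* (fromℕ 6 ℚ.+ fromℕ n) ℚ.+ (ℚ.- fromℕ 5 ℚ.- fromℕ 2)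
      ≡⟨ solve 1 (λ n → con 1ℚ :* (con (fromℕ 6) :+ n) :+ (:- con (fromℕ 5) :- con (fromℕ 2))
           := n :+ con (ℚ.- 1ℚ)) refl (fromℕ n) ⟩
    fromℕ n ℚ.+ ℚ.- 1ℚ
      <⟨ ℚₚ.+-monoʳ-< (fromℕ n) (toWitness {a? = ℚ.- 1ℚ ℚ.<? 0ℚ} _) ⟩
    fromℕ n ℚ.+ 0ℚ
      ≡⟨ ℚₚ.+-identityʳ (fromℕ n) ⟩
    fromℕ n ∎
  where
  open ℚₚ.≤-Reasoning
  q = fromℕ (6 + n)
  0≤q : ℚ.NonNegative q
  0≤q = fromℕ-nonNegative (6 + n)
  5≤εq : fromℕ 5 ℚ.≤ ε ℚ.* q
  5≤εq = ℚₚ.≤-trans 5≤εn (ℚₚ.*-monoˡ-≤-nonNeg ε {{ℚ.nonNegative (ℚₚ.<⇒≤ 0<ε)}}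
    (fromℕ-mono-≤ (m≤n+m n 6)))

exceeds-5 : ∀ ε → 0ℚ ℚ.< ε → ∃[ n ] (fromℕ 5 ℚ.≤ ε ℚ.* fromℕ n × 2 ≤ n)
exceeds-5 ε 0<ε with archimedean ε 0<ε
-- Taking `suc K` for `K` gives `2 ≤ n` without a proof that `K` is positive.
... | K , 1≤εK = 5 * suc K , 5≤ε5K , ≤-trans (s≤s (s≤s z≤n)) (*-monoʳ-≤ 5 (s≤s (z≤n {K})))
  where
  5≤ε5K : fromℕ 5 ℚ.≤ ε ℚ.* fromℕ (5 * suc K)
  5≤ε5K = ℚₚ.≤-trans (ℚₚ.*-monoˡ-≤-nonNeg (fromℕ 5) 1≤εK)
    (subst (ℚ._≤ ε ℚ.* fromℕ (5 * suc K))
      (trans (cong (ε ℚ.*_) (fromℕ-* 5 K))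
        (solve 2 (λ ε k → ε :* (con (fromℕ 5) :* k) := con (fromℕ 5) :* (ε :* k)) refl ε (fromℕ K)))
      (ℚₚ.*-monoˡ-≤-nonNeg ε {{ℚ.nonNegative (ℚₚ.<⇒≤ 0<ε)}} (fromℕ-mono-≤ (*-monoʳ-≤ 5 (m≤n+m K 1)))))

propositionC1 : (∀ (N₀ : ℕ) → ∃[ q ] (N₀ ≤ q ×
    (∃[ n ] Σ[ G ∈ Graph n ] Σ[ D ∈ Subset n ] Σ[ o ∈ OwnerAssignment G D ]
    (Planar G × IsDominating G D × ∣ D ∣ ≡ q ×
    + W G o ≡ + 4 ℤ.* + ∣ D ∣ ℤ.- + 12 ×
    + ∣ A G o ∣ ≡ + ∣ D ∣ ℤ.- + 6 ×
    IsMinimumDominating G D))))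
    ×
    ¬ (Σ[ c ∈ ℝ ] (seq c <ˢ const 1ℚ ×
    (∀ (n : ℕ) (G : Graph n) → Planar G →
    ∀ (D : Subset n) → IsMinimumDominating G D →
    ∀ (o : OwnerAssignment G D) →
    const (fromℕ ∣ A G o ∣)
    ≤ˢ (λ i → (seq c i ℚ.* fromℕ ∣ D ∣ ℚ.- fromℕ 3) ⁺))))
propositionC1 = (λ N₀ → let q = 6 + N₀ in
    q , m≤n+m N₀ 6 , q * 2 , corona q , leaves q , assignment q ,
    drawing (q * 2) , dominating q , ∣leaves∣ q ,
    W-equation N₀ (W≡ N₀) (∣leaves∣ q) ,
    A-equation N₀ (∣A∣≡ N₀) (∣leaves∣ q) ,
    minimum q) ,
  λ (c , (ε , 0<ε , n₁ , c+ε≤1) , bound) →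
    let n , 5≤εn , 2≤n = exceeds-5 ε 0<ε
        q = 6 + n
        -- The relation `≤ˢ` holds termwise only up to a positive error from some index on; error 1
        -- is small enough here.
        n₂ , A≤ = bound (q * 2) (corona q) (drawing (q * 2)) (leaves q) (minimum q) (assignment q)
                    1ℚ (toWitness {a? = 0ℚ ℚ.<? 1ℚ} _)
        -- From this index on both the gap between `c` and 1 and the assumed bound are in force.
        i = n₁ ℕ.⊔ n₂
    in ℚₚ.<-irrefl refl (ℚₚ.<-≤-trans
         (bound-too-small (seq c i) n 0<ε (c+ε≤1 i (m≤m⊔n n₁ n₂)) 5≤εn 2≤n)
         (subst₂ (λ a s → fromℕ a ℚ.≤ (seq c i ℚ.* fromℕ s ℚ.- fromℕ 3) ⁺ ℚ.+ 1ℚ)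
           (∣A∣≡ n) (∣leaves∣ q) (A≤ i (m≤n⊔m n₁ n₂))))
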